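{- Let $e$ be a regular expression over a finite nonempty alphabet $\Sigma$, let $D=(Q,F,q_0,\Sigma,\delta)$ be a deterministic finite automaton equivalent to the regular expression $\Sigma^*e$, and let $M=\mathrm{BuildOFA}(D)$ be the offsetting finite automaton constructed from $D$ as described in the context. Then for every string $s\in\Sigma^*$ the algorithm $\mathrm{MatchUsingOFA}(M,s)$ described in the context solves $\mathrm{FindEndPositions}(s,e)$: the set of positions it returns is exactly the set of positions $p$ with $0\le p\le len(s)$ that mark the end of a match to $e$, i.e. such that the substring $s[i..p]$ matches $e$ for some $0\le i\le p$. Moreover, during its execution the algorithm never processes a character of the input more than once (each index of $s$ is read at most once), so it reads at most $len(s)$ characters.
   Context: DFA: finite state set $Q$, initial state $q_0$, final states $F\subseteq Q$, total transition function $\delta:Q\times\Sigma\to Q$, extended to strings by $\delta(q,\varepsilon)=q$, $\delta(q,c+t)=\delta(\delta(q,c),t)$; it matches $s$ when $\delta(q_0,s)\in F$. Characters of $s$ are $s[0],\dots,s[len(s)-1]$; $s[i..j]$ is the substring of length $j-i$ consisting of $s[i],\dots,s[j-1]$ (empty if $i=j$). Positions $0,\dots,len(s)$ lie between characters. Offsetting finite automaton (OFA): a set of states $Q_M$, final states $F_M\subseteq Q_M$, an initial state $q0_M\in Q_M$, a transition function $\delta_M:Q_M\times\Sigma\to Q_M$, an index offset function $\Theta:Q_M\times\Sigma\to\mathbb Z$, and a position offset function $\Phi:F_M\cup\{q0_M\}\to\mathbb Z$. Tries: a trie is a finite tree that is either a leaf $T$, carrying a state $state(T)\in Q$, or a trie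 node $T$, having exactly one child trie $child(T,c)$ for each $c\in\Sigma$. A trie is compressible if it is a trie node, all its children are leaves, and these leaves all carry the same state. $level(T')$ is the distance of a node $T'$ from the root of its trie. Construction of $M=\mathrm{BuildOFA}(D)$: (1) $\mathrm{EvolveAndCompress}(T,c)$: if $T$ is a leaf, return a leaf with state $\delta(state(T),c)$. If $T$ is a trie node, form the trie node $T'$ with $child(T',x)=\mathrm{EvolveAndCompress}(child(T,x),c)$ for each $x\in\Sigma$; if $T'$ is compressible return one of its (equal) leaf children, otherwise return $T'$. (2) $\mathrm{GrowTrie}(T)$: the trie node with $child(\cdot,c)=\mathrm{EvolveAndCompress}(T,c)$ for each $c\in\Sigma$ (this root is not itself compressed). (3) $\mathrm{BuildTrie}(q)$: start with $T=\mathrm{GrowTrie}(\text{leaf with state }q)$ and $g=1$. While no leaf of $T$ carries a state in $F$ and a budget function $\mathrm{BudgetAllowsBiggerTrie}(q,T,g)$ returns true, replace $T$ by $\mathrm{GrowTrie}(T)$ and $g$ by $g+1$. The budget function is a customizable Boolean function for which this loop terminates for every $q$ (for instance "$g<12$"). The result is the trie $T_q$ and the lookahead $look(q)=g\ge 1$. The tries $T_q$, $q\in Q$, are disjoint, i.e. nodes of different tries are distinct objects. (4) For each trie node $T'$ of a trie $T_q$ and each $c\in\Sigma$, with $T''=child(T',c)$: put $offset(T',c)=-1$ if $T''$ is a trie node, and $offset(T',c)=level(T')+look(state(T''))$ if $T''$ is a leaf. (5) Every transition to a leaf $T''$ is then redirected to the root of $T_{state(T'')}$. (6) $q0_M$ is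 the root of $T_{q_0}$; $Q_M$ is the set of trie nodes reachable from $q0_M$ through the redirected child maps; $F_M$ is the set of those roots of $T_q$ with $q\in F$ that lie in $Q_M$; $\delta_M(T',c)=child(T',c)$ (after redirection); $\Theta(T',c)=offset(T',c)$; and $\Phi(\text{root of }T_q)=look(q)-1$ wherever $\Phi$ is required to be defined. Algorithm $\mathrm{MatchUsingOFA}(M,s)$: initialize the result set to $\{0\}$ if $q0_M\in F_M$ and to $\emptyset$ otherwise; set $cur=q0_M$ and $index=\Phi(q0_M)$. While $index<len(s)$: read $c=s[index]$; set $index:=index+\Theta(cur,c)$; set $cur:=\delta_M(cur,c)$; if (the new) $cur\in F_M$, add $index-\Phi(cur)$ to the result set. Return the result set. -}

module Defs where

open import Data.Bool.Base using (Bool; true)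
open import Data.Fin.Base using (Fin; toℕ)
open import Data.Fin.Properties using (_≟_; any?; all?; ≤-preorder)
open import Data.Fin.Subset using (Subset; _∈_; _∉_)
open import Data.Fin.Subset.Properties using (_∈?_)
open import Data.Integer.Base as ℤ using (ℤ; +_; -[1+_])
import Data.Irrelevant as Irrelevant
open import Data.List.Base using (List; []; _∷_; [_]; foldl; length; take; drop; lookup)
import Data.List.Membership.Propositional as List
open import Data.Nat.Base using (ℕ; suc; _∸_; _≤_)
  renaming (_+_ to _ℕ+_)
open import Data.Product.Base using (_×_; _,_; ∃; ∃₂; proj₁; proj₂)
open import Data.Refinement.Base using (Refinement-syntax; _,_)
open import Data.Sum.Base using (_⊎_; inj₁; inj₂; map₂)
open import Function.Bundles using (_⇔_)
open import Level using (0ℓ)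
open import Relation.Binary.PropositionalEquality.Core using (_≡_; refl; cong)
open import Relation.Nullary using (¬_; Dec; yes; no; map′)
open import Relation.Unary using (Pred; Decidable)
import Text.Regex.Base as Regex

private
  variable
    n k : ℕ

-- The library's regular expressions are over a preorder, which only
-- matters for the range expressions a ─ b; Fin k carries its usual order.

RegExp : ℕ → Set
RegExp k = Regex.Exp (≤-preorder k)

_matches_ : List (Fin k) → RegExp k → Set
_matches_ {k} = Regex._∈_ (≤-preorder k)

Σ*∙_ : RegExp k → RegExp k
Σ*∙_ {k} e = (· ⋆) ∙ e
  where open Regex (≤-preorder k)

record DFA (n k : ℕ) : Set where
  field
    q₀ : Fin n
    F  : Subset n
    δ  : Fin n → Fin k → Fin n

  δ* : Fin n → List (Fin k) → Fin n
  δ* = foldl δ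

  Accepts : List (Fin k) → Set
  Accepts s = δ* q₀ s ∈ F

_EquivalentTo_ : DFA n k → RegExp k → Set
D EquivalentTo e = ∀ s → DFA.Accepts D s ⇔ s matches e

substring : List (Fin k) → ℕ → ℕ → List (Fin k)
substring s i j = take (j ∸ i) (drop i s)

EndOfMatch : List (Fin k) → RegExp k → ℕ → Set
EndOfMatch s e p =
  p ≤ length s × ∃ λ i → i ≤ p × substring s i p matches e

-- The list R stands for the set of its elements. It is a list of
-- integers because the matching algorithm computes positions in ℤ.

SolvesFindEndPositions : List (Fin k) → RegExp k → List ℤ → Set
SolvesFindEndPositions s e R =
  ∀ z → z List.∈ R ⇔ (∃ λ p → z ≡ + p × EndOfMatch s e p)

record OFA (k : ℕ) : Set₁ where
  field
    State  : Set
    Final  : Pred State 0ℓ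
    final? : Decidable Final
    start  : State
    δ      : State → Fin k → State
    Θ      : State → Fin k → ℤ
    Φ      : (x : State) → .(Final x ⊎ x ≡ start) → ℤ

module Matching (M : OFA k) (s : List (Fin k)) where
  open OFA M

  record Config : Set where
    constructor config
    field
      index  : ℤ
      cur    : State
      result : List ℤ
  open Config

  initial : Config
  initial = config (Φ start (inj₂ refl)) start result₀
    where
    result₀ : List ℤ
    result₀ with final? start
    ... | yes _ = [ + 0 ]
    ... | no  _ = []

  body : Config → Fin (length s) → Config
  body σ i = config index′ cur′ result′
    where
    c      = lookup s i
    index′ = index σ ℤ.+ Θ (cur σ) c
    cur′   = δ (cur σ) c

    result′ : List ℤ
    result′ with final? cur′
    ... | yes f = (index′ ℤ.- Φ cur′ (inj₁ f)) ∷ result σ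
    ... | no  _ = result σ

  -- Run σ is R: the while loop started in σ terminates with result R,
  -- having read the indices is, in this order. No rule applies to a
  -- negative index: an execution that tries to read there is stuck and
  -- does not count as a run.

  data Run (σ : Config) : List (Fin (length s)) → List ℤ → Set where
    halt : + length s ℤ.≤ index σ → Run σ [] (result σ)
    loop : ∀ {is R} (i : Fin (length s)) → index σ ≡ + toℕ i →
           Run (body σ i) is R → Run σ (i ∷ is) R

MatchUsingOFA : (M : OFA k) (s : List (Fin k)) →
                List (Fin (length s)) → List ℤ → Set
MatchUsingOFA M s = Run initial
  where open Matching M s

mutual
  data Trie (n k : ℕ) : Set where
    leaf : (state : Fin n) → Trie n k
    node : (child : TrieNode n k) → Trie n k

  TrieNode : ℕ → ℕ → Set
  TrieNode n k = Fin k → Trie n k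

data _∈Leaves_ {n k : ℕ} (q : Fin n) : Trie n k → Set where
  leaf : q ∈Leaves leaf q
  node : ∀ {T : TrieNode n k} c → q ∈Leaves T c → q ∈Leaves node T

Compressible : TrieNode n k → Set
Compressible T = ∃ λ q → ∀ c → T c ≡ leaf q

isLeaf? : (T : Trie n k) (q : Fin n) → Dec (T ≡ leaf q)
isLeaf? (leaf p) q = map′ (cong leaf) (λ { refl → refl }) (p ≟ q)
isLeaf? (node _) q = no λ ()

compressible? : (T : TrieNode n k) → Dec (Compressible T)
compressible? T = any? λ q → all? λ c → isLeaf? (T c) q

compress : TrieNode n k → Trie n k
compress T with compressible? T
... | yes (q , _) = leaf q
... | no  _       = node T

-- The nodes, as distinct objects, of a trie that are trie nodes: each
-- is given by the path leading to it from the root.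

data NodeIn : Trie n k → Set where
  here  : ∀ {T : TrieNode n k} → NodeIn (node T)
  there : ∀ {T : TrieNode n k} c → NodeIn (T c) → NodeIn (node T)

level : ∀ {T : Trie n k} → NodeIn T → ℕ
level here        = 0
level (there _ x) = suc (level x)

rootOf : (T : Trie n k) → Fin n ⊎ NodeIn T
rootOf (leaf q) = inj₁ q
rootOf (node T) = inj₂ here

-- The child of a node before redirection: the state of the child if it
-- is a leaf, and the child itself if it is a trie node.

child : ∀ {T : Trie n k} → NodeIn T → Fin k → Fin n ⊎ NodeIn T
child (here {T = T}) c = map₂ (there c) (rootOf (T c))
child (there d x)    c = map₂ (there d) (child x c)

Budget : ℕ → ℕ → Set
Budget n k = Fin n → Trie n k → ℕ → Bool

module Build (D : DFA n k) (budgetAllowsBiggerTrie : Budget n k) where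
  open DFA D

  evolveAndCompress : Trie n k → Fin k → Trie n k
  evolveAndCompress (leaf q) c = leaf (δ q c)
  evolveAndCompress (node T) c = compress λ x → evolveAndCompress (T x) c

  growTrie : Trie n k → TrieNode n k
  growTrie T c = evolveAndCompress T c

  Continue : Fin n → TrieNode n k → ℕ → Set
  Continue q T g =
    (∀ p → p ∈Leaves node T → p ∉ F) ×
    budgetAllowsBiggerTrie q (node T) g ≡ true

  -- Loop q T g T′ g′: the loop of BuildTrie(q), entered with T and g,
  -- terminates with T′ and g′.

  data Loop (q : Fin n) (T : TrieNode n k) (g : ℕ) :
            TrieNode n k → ℕ → Set where
    stop : ¬ Continue q T g → Loop q T g T g
    grow : ∀ {T′ g′} → Continue q T g →
           Loop q (growTrie (node T)) (suc g) T′ g′ → Loop q T g T′ g′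

  Terminates : Set
  Terminates =
    ∀ q → ∃₂ λ T g → Loop q (growTrie (leaf q)) 1 T g

  module _ (terminates : Terminates) where

    trie : Fin n → TrieNode n k
    trie q = proj₁ (terminates q)

    look : Fin n → ℕ
    look q = proj₁ (proj₂ (terminates q))

    Node : Set
    Node = ∃ λ q → NodeIn (node (trie q))

    root : Fin n → Node
    root q = q , here

    offset : Node → Fin k → ℤ
    offset (q , x) c with child x c
    ... | inj₁ p = + (level x ℕ+ look p)
    ... | inj₂ _ = -[1+ 0 ]

    redirected : Node → Fin k → Node
    redirected (q , x) c with child x c
    ... | inj₁ p = root p
    ... | inj₂ y = q , y

    data Reachable : Node → Set where
      start : Reachable (root q₀)
      step  : ∀ {x} → Reachable x → ∀ c → Reachable (redirected x c)

    FinalRoot : Pred Node 0ℓ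
    FinalRoot x = ∃ λ q → q ∈ F × x ≡ root q

    finalRoot? : Decidable FinalRoot
    finalRoot? (q , here) =
      map′ (λ f → q , f , refl) (λ { (_ , f , refl) → f }) (q ∈? F)
    finalRoot? (q , there _ _) = no λ { (_ , _ , ()) }

    -- Φ may ignore the position of its argument within a trie: all
    -- elements of its domain are roots.

    ofa : OFA k
    ofa = record
      { State  = [ x ∈ Node ∣ Reachable x ]
      ; Final  = λ (x , _) → FinalRoot x
      ; final? = λ (x , _) → finalRoot? x
      ; start  = root q₀ , Irrelevant.[ start ]
      ; δ      = λ (x , r) c →
                   redirected x c , Irrelevant.map (λ r → step r c) r
      ; Θ      = λ (x , _) c → offset x c
      ; Φ      = λ ((q , _) , _) _ → + look q ℤ.- + 1
      }

BudgetTerminates : DFA n k → Budget n k → Set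
BudgetTerminates = Build.Terminates

BuildOFA : (D : DFA n k) (budget : Budget n k) →
           BudgetTerminates D budget → OFA k
BuildOFA = Build.ofa

{-# OPTIONS --safe #-}
-- The trie T_q, of height g = look q, tabulates δ* q on the words of length
-- g, read from their last letter backwards. Since BuildTrie enlarges a trie
-- only as long as none of its leaves is final, no nonempty word shorter than
-- g leads from q to a final state. At the root of T_q the automaton sits at
-- some position p, D being in state q there, and looks at the character
-- p + g - 1; it moves backwards, never past p, until it reaches a leaf. That
-- leaf is the state of D at position p + g, whatever the characters left
-- unread are, and the positions skipped in between are not final.
module Submission where

open import Defs
open import Data.Empty using (⊥-elim)
open import Data.Fin.Base using (Fin; zero; suc; toℕ; fromℕ<)
open import Data.Fin.Properties using (injective⇒≤; toℕ<n; toℕ-fromℕ<; ≤-preorder)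
open import Data.Fin.Subset using (_∈_; _∉_)
open import Data.Fin.Subset.Properties using (_∈?_)
open import Data.Integer.Base as ℤ using (ℤ; +_; -[1+_]; +≤+)
import Data.Integer.Properties as ℤ
open import Data.List.Base using (List; []; _∷_; [_]; _++_; _∷ʳ_; length; take; drop; lookup; initLast; _∷ʳ′_)
import Data.List.Membership.Propositional as List
open import Data.List.Membership.Propositional.Properties using (∈-lookup)
open import Data.List.Properties using (foldl-++; length-++; length-take; length-drop; ∷ʳ-++; ++-assoc; ++-identityʳ; drop-drop; take++drop≡id; take-[])
open import Data.List.Relation.Ternary.Appending.Propositional as Appending using (break)
open import Data.List.Relation.Unary.All as All using (All; []; _∷_)
open import Data.List.Relation.Unary.AllPairs using ([]; _∷_)
open import Data.List.Relation.Unary.Any using (here; there)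
open import Data.List.Relation.Unary.Unique.Propositional using (Unique)
open import Data.Nat.Base using (ℕ; zero; suc; _+_; _∸_; _≤_; _<_; _⊓_; z≤n; s≤s; NonZero)
open import Data.Nat.Properties hiding (≤-preorder)
open import Data.Product.Base using (_×_; _,_; ∃; ∃₂; proj₁; proj₂)
open import Data.Refinement.Base using (value; _,_)
open import Data.Sum.Base using (_⊎_; inj₁; inj₂; [_,_]′)
open import Function.Bundles using (_⇔_; mk⇔; Equivalence)
open import Relation.Binary.PropositionalEquality hiding ([_])
open import Relation.Nullary using (¬_; yes; no)
import Text.Regex.Base as Regex

open Equivalence using (to; from)

private
  variable
    A : Set
    n k : ℕ

-- Lists

take-+ : ∀ m l (xs : List A) → take (m + l) xs ≡ take m xs ++ take l (drop m xs)
take-+ zero    l xs       = refl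
take-+ (suc m) zero    [] = refl
take-+ (suc m) (suc l) [] = refl
take-+ (suc m) l (x ∷ xs) = cong (x ∷_) (take-+ m l xs)

drop-lookup : ∀ (xs : List A) i → drop (toℕ i) xs ≡ lookup xs i ∷ drop (suc (toℕ i)) xs
drop-lookup (x ∷ xs) zero    = refl
drop-lookup (x ∷ xs) (suc i) = drop-lookup xs i

drop-length-++ : ∀ (xs ys : List A) → drop (length xs) (xs ++ ys) ≡ ys
drop-length-++ []       ys = refl
drop-length-++ (x ∷ xs) ys = drop-length-++ xs ys

-- Tries branch on the last letter first, so words are taken apart at their end.
split-last : ∀ {m} (xs : List A) → length xs ≡ suc m →
             ∃₂ λ ys y → length ys ≡ m × xs ≡ ys ∷ʳ y
split-last xs eq with initLast xs
split-last _ ()  | []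
split-last _ eq  | ys ∷ʳ′ y =
  ys , y , suc-injective (trans (+-comm 1 _) (trans (sym (length-++ ys)) eq)) , refl

Unique⇒lookup-injective : ∀ {xs : List A} → Unique xs → ∀ {i j} → lookup xs i ≡ lookup xs j → i ≡ j
Unique⇒lookup-injective (_ ∷ _)  {zero}  {zero}  eq = refl
Unique⇒lookup-injective (p ∷ _)  {zero}  {suc j} eq = ⊥-elim (All.lookup p (∈-lookup j) eq)
Unique⇒lookup-injective (p ∷ _)  {suc i} {zero}  eq = ⊥-elim (All.lookup p (∈-lookup i) (sym eq))
Unique⇒lookup-injective (_ ∷ u)  {suc i} {suc j} eq = cong suc (Unique⇒lookup-injective u eq)

Unique⇒length≤ : ∀ {m} {xs : List (Fin m)} → Unique xs → length xs ≤ m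
Unique⇒length≤ u = injective⇒≤ (Unique⇒lookup-injective u)

-- Regular expressions

matches-·⋆ : ∀ (s : List (Fin k)) → let open Regex (≤-preorder k) in s matches (· ⋆)
matches-·⋆ []      = Regex.star (Regex.sum (inj₁ Regex.ε))
matches-·⋆ (c ∷ s) = Regex.star (Regex.sum (inj₂
  (Regex.prod ([ c ] Appending.++ s) Regex.[^ [] ] (matches-·⋆ s))))

-- The star absorbs any prefix whatsoever, so only the place of the cut matters. It is given as an
-- index, as in `EndOfMatch`.
matches-Σ*∙ : ∀ (w : List (Fin k)) e →
              w matches (Σ*∙ e) ⇔ (∃ λ i → i ≤ length w × drop i w matches e)
matches-Σ*∙ {k} w e = mk⇔ f g
  where
  f : w matches (Σ*∙ e) → ∃ λ i → i ≤ length w × drop i w matches e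
  f (Regex.prod {u} {v} app _ m) with refl ← break app =
    length u , ≤-trans (m≤m+n _ _) (≤-reflexive (sym (length-++ u))) ,
    subst (_matches e) (sym (drop-length-++ u v)) m

  g : (∃ λ i → i ≤ length w × drop i w matches e) → w matches (Σ*∙ e)
  g (i , _ , m) = subst (_matches (Σ*∙ e)) (take++drop≡id i w)
    (Regex.prod (take i w Appending.++ drop i w) (matches-·⋆ (take i w)) m)

drop-take : ∀ i p (s : List A) → drop i (take p s) ≡ take (p ∸ i) (drop i s)
drop-take zero    p       s       = refl
drop-take (suc i) zero    s       = refl
drop-take (suc i) (suc p) []      = sym (take-[] (p ∸ i))
drop-take (suc i) (suc p) (_ ∷ s) = drop-take i p s

-- The candidates s[i..p] are the suffixes of `take p s`, and the starred factor makes their start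
-- arbitrary. The question becomes one about prefixes, which `D` decides.
endOfMatch⇔ : ∀ (s : List (Fin k)) e p →
              EndOfMatch s e p ⇔ (p ≤ length s × take p s matches (Σ*∙ e))
endOfMatch⇔ s e p = mk⇔
  (λ (p≤ , i , i≤p , m) → p≤ , from (matches-Σ*∙ (take p s) e)
    (i , subst (i ≤_) (sym (len p≤)) i≤p , subst (_matches e) (sym (drop-take i p s)) m))
  (λ (p≤ , m) → let i , i≤ , m′ = to (matches-Σ*∙ (take p s) e) m in
    p≤ , i , subst (i ≤_) (len p≤) i≤ , subst (_matches e) (drop-take i p s) m′)
  where
  len : p ≤ length s → length (take p s) ≡ p
  len p≤ = trans (length-take p s) (m≤n⇒m⊓n≡m p≤)

-- Tries

-- Resolves D q m u T: once the suffix u of a word v ++ u is known, T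
-- tabulates δ* q (v ++ u) on the words v of length m, last letter first.

data Resolves (D : DFA n k) (q : Fin n) : ℕ → List (Fin k) → Trie n k → Set where
  leaf : ∀ {m u p} → (∀ v → length v ≡ m → DFA.δ* D q (v ++ u) ≡ p) →
         Resolves D q m u (leaf p)
  node : ∀ {m u} {T : TrieNode n k} → (∀ c → Resolves D q m (c ∷ u) (T c)) →
         Resolves D q (suc m) u (node T)

subtrie : ∀ {T : Trie n k} → NodeIn T → TrieNode n k
subtrie (here {T = T}) = T
subtrie (there _ x)    = subtrie x

rootOf-leaf : ∀ (T : Trie n k) {p} → rootOf T ≡ inj₁ p → T ≡ leaf p
rootOf-leaf (leaf _) refl = refl

rootOf-node : ∀ (T : Trie n k) {y} → rootOf T ≡ inj₂ y → level y ≡ 0 × T ≡ node (subtrie y)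
rootOf-node (node _) refl = refl , refl

-- `child` works on paths while `Resolves` speaks of subtries; this lemma and `child-node`
-- translate.
child-leaf : ∀ {T : Trie n k} (x : NodeIn T) c {p} → child x c ≡ inj₁ p →
             subtrie x c ≡ leaf p
child-leaf (here {T = T}) c eq with rootOf (T c) in eq′ | eq
... | inj₁ _ | refl = rootOf-leaf (T c) eq′
child-leaf (there d x) c eq with child x c in eq′ | eq
... | inj₁ _ | refl = child-leaf x c eq′

child-node : ∀ {T : Trie n k} (x : NodeIn T) c {y} → child x c ≡ inj₂ y →
             level y ≡ suc (level x) × subtrie x c ≡ node (subtrie y)
child-node (here {T = T}) c eq with rootOf (T c) in eq′ | eq
... | inj₂ _ | refl with rootOf-node (T c) eq′
...   | l , t = cong suc l , t
child-node (there d x) c eq with child x c in eq′ | eq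
... | inj₂ _ | refl with child-node x c eq′
...   | l , t = cong suc l , t

-- Correctness of the constructed tries

module _ {n k : ℕ} (D : DFA n k) where
  open DFA D

  δ*-++ : ∀ q u v → δ* q (u ++ v) ≡ δ* (δ* q u) v
  δ*-++ q u v = foldl-++ δ q u v

  -- If all children are the same leaf, the last letter of the word has no influence on the state,
  -- so that leaf already answers for words one letter longer.
  Resolves-compress : ∀ {q m u} {T : TrieNode n k} →
                      Resolves D q m u (node T) → Resolves D q m u (compress T)
  Resolves-compress {T = T} r with compressible? T
  ... | no _ = r
  Resolves-compress {q} {suc m} {u} {T} (node r) | yes (p , all) = leaf h
    where
    h : ∀ v → length v ≡ suc m → δ* q (v ++ u) ≡ p
    h v len with v′ , c , len′ , refl ← split-last v len with T c | all c | r c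
    ... | _ | refl | leaf r′ = trans (cong (δ* q) (∷ʳ-++ v′ c u)) (r′ v′ len′)

  -- A trie node still waits for a letter. This makes `look q` positive at a root and, further down,
  -- keeps the index from passing below `p`.
  Resolves-positive : ∀ {q m u} {T : TrieNode n k} → Resolves D q m u (node T) →
                      ∃ λ m′ → m ≡ suc m′
  Resolves-positive (node _) = _ , refl

  -- The letters of `v`, taken from the last, lead to a leaf that carries the state reached.
  nonfinal-leaves : ∀ {q m u T} → Resolves D q m u T → (∀ p → p ∈Leaves T → p ∉ F) →
                    ∀ v → length v ≡ m → δ* q (v ++ u) ∉ F
  nonfinal-leaves (leaf r) nonfinal v len f =
    nonfinal _ leaf (subst (_∈ F) (r v len) f)
  nonfinal-leaves {q} {u = u} (node r) nonfinal v len f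
    with v′ , c , len′ , refl ← split-last v len =
    nonfinal-leaves (r c) (λ p l → nonfinal p (node c l)) v′ len′
      (subst (λ w → δ* q w ∈ F) (∷ʳ-++ v′ c u) f)

  -- The empty word is exempt because `q` itself may be final; that position is recorded on arrival
  -- at the root.
  NonfinalBelow : Fin n → ℕ → Set
  NonfinalBelow q g = ∀ v → 1 ≤ length v → length v < g → δ* q v ∉ F

  module _ (budget : Budget n k) where
    open Build D budget

    -- `D` reads `c` after the whole word, so `c` goes to the far end of the known suffix.
    Resolves-evolve : ∀ {q m u T} → Resolves D q m u T → ∀ c →
                      Resolves D q m (u ∷ʳ c) (evolveAndCompress T c)
    Resolves-evolve {q} {m} {u} {leaf p} (leaf r) c = leaf λ v len → begin
      δ* q (v ++ u ∷ʳ c)          ≡⟨ cong (δ* q) (++-assoc v u [ c ]) ⟨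
      δ* q ((v ++ u) ∷ʳ c)        ≡⟨ δ*-++ q (v ++ u) [ c ] ⟩
      δ (δ* q (v ++ u)) c         ≡⟨ cong (λ p → δ p c) (r v len) ⟩
      δ p c                       ∎
      where
      open ≡-Reasoning
    Resolves-evolve (node r) c = Resolves-compress (node λ x → Resolves-evolve (r x) c)

    Resolves-grow : ∀ {q m T} → Resolves D q m [] T → Resolves D q (suc m) [] (node (growTrie T))
    Resolves-grow r = node (Resolves-evolve r)

    -- Another round is made only if no leaf is final, which rules out the words of length exactly
    -- `g` and raises the bound by one.
    Loop-correct : ∀ {q T g T′ g′} → Loop q T g T′ g′ →
                   Resolves D q g [] (node T) → NonfinalBelow q g →
                   Resolves D q g′ [] (node T′) × NonfinalBelow q g′
    Loop-correct (stop _) r nf = r , nf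
    Loop-correct {q} {g = g} (grow (leaves , _) l) r nf =
      Loop-correct l (Resolves-grow r) nf′
      where
      nf′ : NonfinalBelow q (suc g)
      nf′ v 1≤v v<1+g with m≤n⇒m<n∨m≡n (≤-pred v<1+g)
      ... | inj₁ v<g = nf v 1≤v v<g
      ... | inj₂ v≡g = subst (λ w → δ* q w ∉ F) (++-identityʳ v)
                         (nonfinal-leaves r leaves v v≡g)

    module _ (terminates : Terminates) where

      trie-correct : ∀ q → Resolves D q (look terminates q) [] (node (trie terminates q)) ×
                           NonfinalBelow q (look terminates q)
      trie-correct q = Loop-correct (proj₂ (proj₂ (terminates q)))
        -- The lone leaf before the first growth tabulates the empty word; no nonempty word is
        -- shorter than one.
        (Resolves-grow (leaf λ { [] _ → refl }))
        (λ v 1≤v v<1 → ⊥-elim (<⇒≱ v<1 1≤v))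

-- Runs

-- For a jump from index `i` at level `l`: the new position is `suc (i + l)`, and the offset leaves
-- the index `Φ` characters beyond it.
jump-index : ∀ i l g → + (i + (l + g)) ≡ + suc (i + l) ℤ.+ (+ g ℤ.- + 1)
jump-index i l g = trans (cong +_ (sym (+-assoc i l g))) (ℤ.+-assoc (+ suc (i + l)) (+ g) -[1+ 0 ])

i+j-j≡i : ∀ i j → i ℤ.+ j ℤ.- j ≡ i
i+j-j≡i i j = trans (ℤ.+-assoc i j (ℤ.- j))
  (trans (cong (λ z → i ℤ.+ z) (ℤ.+-inverseʳ j)) (ℤ.+-identityʳ i))

module Correctness {n k : ℕ} (D : DFA n k) (budget : Budget n k)
                   (terminates : BudgetTerminates D budget) (s : List (Fin k)) where
  open DFA D
  private module B = Build D budget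
  open Matching (BuildOFA D budget terminates) s
  open Config

  T[_] : Fin n → Trie n k
  T[ q ] = node (B.trie terminates q)

  look : Fin n → ℕ
  look = B.look terminates

  word : ℕ → ℕ → List (Fin k)
  word a l = take l (drop a s)

  length-word : ∀ a l → a + l ≤ length s → length (word a l) ≡ l
  length-word a l a+l≤ = begin
    length (word a l)        ≡⟨ length-take l (drop a s) ⟩
    l ⊓ length (drop a s)    ≡⟨ cong (l ⊓_) (length-drop a s) ⟩
    l ⊓ (length s ∸ a)       ≡⟨ m≤n⇒m⊓n≡m (m+n≤o⇒m≤o∸n l (subst (_≤ length s) (+-comm a l) a+l≤)) ⟩
    l                        ∎
    where
    open ≡-Reasoning

  word-+ : ∀ a m l → word a (m + l) ≡ word a m ++ word (a + m) l
  word-+ a m l = trans (take-+ m l (drop a s))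
    (cong (λ xs → word a m ++ take l xs) (drop-drop a m s))

  word-suc : ∀ i l → word (toℕ i) (suc l) ≡ lookup s i ∷ word (suc (toℕ i)) l
  word-suc i l = cong (take (suc l)) (drop-lookup s i)

  stateAt : ℕ → Fin n
  stateAt p = δ* q₀ (take p s)

  stateAt-+ : ∀ p l → stateAt (p + l) ≡ δ* (stateAt p) (word p l)
  stateAt-+ p l = trans (cong (δ* q₀) (take-+ p l s)) (δ*-++ D q₀ (take p s) (word p l))

  -- The word from `p` to `j` is nonempty and shorter than the lookahead.
  skipped-nonfinal : ∀ p j → p < j → j < p + look (stateAt p) → j ≤ length s → stateAt j ∉ F
  skipped-nonfinal p j p<j j<p+g j≤ f =
    proj₂ (trie-correct D budget terminates (stateAt p)) (word p l)
      (subst (1 ≤_) (sym len) (m<n⇒0<n∸m p<j))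
      (subst (_< look (stateAt p)) (sym len) (+-cancelˡ-< p _ _ (subst (_< _) (sym p+l≡j) j<p+g)))
      (subst (_∈ F) (trans (cong stateAt (sym p+l≡j)) (stateAt-+ p l)) f)
    where
    l = j ∸ p
    p+l≡j : p + l ≡ j
    p+l≡j = m+[n∸m]≡n (<⇒≤ p<j)
    len : length (word p l) ≡ l
    len = length-word p l (subst (_≤ length s) (sym p+l≡j) j≤)

  -- The loop invariant

  AcceptedUpTo : ℕ → ℤ → Set
  AcceptedUpTo p z = ∃ λ j → z ≡ + j × j ≤ p × stateAt j ∈ F

  -- D is in state q at position p. The index to be read is p + m, and the
  -- level x characters after it, up to position p + look q, have been read.

  record Invariant (σ : Config) (p m : ℕ) (q : Fin n) (x : NodeIn T[ q ]) : Set where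
    field
      index≡   : index σ ≡ + (p + m)
      cur≡     : value (cur σ) ≡ (q , x)
      state≡   : stateAt p ≡ q
      look≡    : look q ≡ suc m + level x
      resolves : Resolves D q (suc m) (word (suc (p + m)) (level x)) (node (subtrie x))
      -- At a root nothing of the window has been read, and the window may extend beyond the end of
      -- `s`.
      inside   : level x ≡ 0 ⊎ suc (p + m) + level x ≤ length s
      p≤       : p ≤ length s
      result⇔  : ∀ z → z List.∈ result σ ⇔ AcceptedUpTo p z
  open Invariant

  -- Serves both the start and every jump. The known suffix is empty at a root, and `m` is `look q`
  -- less one, the value of `Φ`.
  root-invariant : ∀ {σ p q} → index σ ≡ + p ℤ.+ (+ look q ℤ.- + 1) → value (cur σ) ≡ (q , here) →
                   stateAt p ≡ q → p ≤ length s →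
                   (∀ z → z List.∈ result σ ⇔ AcceptedUpTo p z) → ∃ λ m → Invariant σ p m q here
  root-invariant {σ} {p} {q} i≡ c≡ s≡ p≤ r⇔
    with m , look≡ ← Resolves-positive D (proj₁ (trie-correct D budget terminates q)) = m , record
    { index≡   = trans i≡ (cong (λ g → + p ℤ.+ (+ g ℤ.- + 1)) look≡)
    ; cur≡     = c≡
    ; state≡   = s≡
    ; look≡    = trans look≡ (sym (+-identityʳ (suc m)))
    ; resolves = subst (λ g → Resolves D q g [] T[ q ]) look≡ (proj₁ (trie-correct D budget terminates q))
    ; inside   = inj₁ refl
    ; p≤       = p≤
    ; result⇔  = r⇔
    }

  FinalRoot⇒∈F : ∀ {q} → B.FinalRoot terminates (q , here) → q ∈ F
  FinalRoot⇒∈F (_ , f , refl) = f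

  FinalRoot⇒level≡0 : ∀ {q x} → B.FinalRoot terminates (q , x) → level x ≡ 0
  FinalRoot⇒level≡0 (_ , _ , refl) = refl

  AcceptedAt0 : ∀ z → z List.∈ result initial ⇔ AcceptedUpTo 0 z
  AcceptedAt0 z with q₀ ∈? F
  ... | yes f = mk⇔ (λ { (here refl) → 0 , refl , z≤n , f }) (λ { (_ , refl , z≤n , _) → here refl })
  ... | no ¬f = mk⇔ (λ ()) (λ { (_ , _ , z≤n , f) → ⊥-elim (¬f f) })

  initial-invariant : ∃ λ m → Invariant initial 0 m q₀ here
  initial-invariant = root-invariant (sym (ℤ.+-identityˡ _)) refl refl z≤n AcceptedAt0

  -- One iteration of the loop

  result-body : ∀ σ i {y} → value (cur (body σ i)) ≡ y → ∀ z →
                z List.∈ result (body σ i) ⇔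
                (z List.∈ result σ ⊎
                 B.FinalRoot terminates y × z ≡ index (body σ i) ℤ.- (+ look (proj₁ y) ℤ.- + 1))
  result-body σ i refl z with B.finalRoot? terminates (value (cur (body σ i)))
  ... | yes f = mk⇔ (λ { (here refl) → inj₂ (f , refl) ; (there z∈) → inj₁ z∈ })
                    (λ { (inj₁ z∈) → there z∈ ; (inj₂ (_ , refl)) → here refl })
  ... | no ¬f = mk⇔ inj₁ (λ { (inj₁ z∈) → z∈ ; (inj₂ (f , _)) → ⊥-elim (¬f f) })

  redirected-leaf : ∀ {q p} (x : NodeIn T[ q ]) c → child x c ≡ inj₁ p →
                    B.redirected terminates (q , x) c ≡ (p , here) ×
                    B.offset terminates (q , x) c ≡ + (level x + look p)
  redirected-leaf x c eq with child x c | eq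
  ... | inj₁ _ | refl = refl , refl

  redirected-node : ∀ {q} (x y : NodeIn T[ q ]) c → child x c ≡ inj₂ y →
                    B.redirected terminates (q , x) c ≡ (q , y) ×
                    B.offset terminates (q , x) c ≡ -[1+ 0 ]
  redirected-node x y c eq with child x c | eq
  ... | inj₂ _ | refl = refl , refl

  AcceptedUpTo-skip : ∀ {p r} → p ≤ r → (∀ j → p < j → j ≤ r → stateAt j ∉ F) →
                      ∀ z → AcceptedUpTo p z ⇔ AcceptedUpTo r z
  AcceptedUpTo-skip {p} {r} p≤r nonfinal z =
    mk⇔ (λ (j , z≡ , j≤p , f) → j , z≡ , ≤-trans j≤p p≤r , f) g
    where
    g : AcceptedUpTo r z → AcceptedUpTo p z
    g (j , z≡ , j≤r , f) with j ≤? p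
    ... | yes j≤p = j , z≡ , j≤p , f
    ... | no  j≰p = ⊥-elim (nonfinal j (≰⇒> j≰p) j≤r f)

  AcceptedUpTo-suc : ∀ p z → AcceptedUpTo (suc p) z ⇔
                     (AcceptedUpTo p z ⊎ stateAt (suc p) ∈ F × z ≡ + suc p)
  AcceptedUpTo-suc p z = mk⇔ f λ
    { (inj₁ (j , z≡ , j≤p , f)) → j , z≡ , m≤n⇒m≤1+n j≤p , f
    ; (inj₂ (f , z≡))           → suc p , z≡ , ≤-refl , f }
    where
    f : AcceptedUpTo (suc p) z → AcceptedUpTo p z ⊎ stateAt (suc p) ∈ F × z ≡ + suc p
    f (j , z≡ , j≤1+p , f) with m≤n⇒m<n∨m≡n j≤1+p
    ... | inj₁ j<1+p = inj₁ (j , z≡ , ≤-pred j<1+p , f)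
    ... | inj₂ refl  = inj₂ (f , z≡)

  -- Shared by the proofs of termination and correctness. The position after a jump is the end of
  -- the old window, `p` plus the lookahead.
  data Step (σ : Config) (p m l : ℕ) : Set where
    down : ∀ {m′ q y} → m ≡ suc m′ → level y ≡ suc l → Invariant σ p m′ q y → Step σ p m l
    jump : ∀ {m′ q} → Invariant σ (suc (p + m + l)) m′ q here → Step σ p m l

  end≤length : ∀ {σ p m q x} → Invariant σ p m q x → p + m < length s →
               suc (p + m) + level x ≤ length s
  end≤length {x = x} I i< with inside I
  ... | inj₁ l≡0 rewrite l≡0 = subst (_≤ length s) (sym (+-identityʳ _)) i<
  ... | inj₂ le  = le

  -- The character at `p + m` is the last unread one of the window; reading it puts it in front of
  -- the known suffix.
  resolves-child : ∀ {σ p m q x} → Invariant σ p m q x → (i : Fin (length s)) → p + m ≡ toℕ i →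
                   Resolves D q m (word (p + m) (suc (level x))) (subtrie x (lookup s i))
  resolves-child {p = p} {m} {q} {x} I i i≡ with resolves I
  ... | node r = subst (λ w → Resolves D q m w (subtrie x (lookup s i))) word≡ (r (lookup s i))
    where
    word≡ : lookup s i ∷ word (suc (p + m)) (level x) ≡ word (p + m) (suc (level x))
    word≡ rewrite i≡ = sym (word-suc i (level x))

  step-down : ∀ {σ p m q x y} (i : Fin (length s)) → p + suc m ≡ toℕ i → Invariant σ p (suc m) q x →
              child x (lookup s i) ≡ inj₂ y → Step (body σ i) p (suc m) (level x)
  -- Splitting the state exposes its node, so that `cur≡` can be matched with `refl`.
  step-down {σ@(config _ (_ , _) _)} {p} {m} {q} {x} {y} i i≡
    I@(record { index≡ = refl ; cur≡ = refl }) ch = down refl level≡ record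
      { index≡   = trans (cong (λ o → + (p + suc m) ℤ.+ o) offset≡) (cong (λ i → + i ℤ.- + 1) (+-suc p m))
      ; cur≡     = redirected≡
      ; state≡   = state≡ I
      ; look≡    = trans (look≡ I) (cong suc (trans (sym (+-suc m (level x))) (cong (λ l → m + l) (sym level≡))))
      ; resolves = subst₂ (Resolves D q (suc m))
                     (cong₂ word (+-suc p m) (sym level≡)) subtrie≡ (resolves-child I i i≡)
      ; inside   = inj₂ (subst (_≤ length s) end≡ (end≤length I (subst (_< length s) (sym i≡) (toℕ<n i))))
      ; p≤       = p≤ I
      ; result⇔  = λ z → mk⇔
          -- A node below the root is never final, so nothing is recorded.
          (λ z∈ → to (result⇔ I z) ([ (λ z∈ → z∈) , (λ (f , _) → ⊥-elim (not-root f)) ]′ (to (res z) z∈)))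
          (λ acc → from (res z) (inj₁ (from (result⇔ I z) acc)))
      }
    where
    level≡ = proj₁ (child-node x (lookup s i) ch)
    subtrie≡ = proj₂ (child-node x (lookup s i) ch)
    redirected≡ = proj₁ (redirected-node x y (lookup s i) ch)
    offset≡ = proj₂ (redirected-node x y (lookup s i) ch)
    res = result-body σ i redirected≡
    not-root : ¬ B.FinalRoot terminates (q , y)
    not-root f with () ← trans (sym (FinalRoot⇒level≡0 f)) level≡
    end≡ : suc (p + suc m) + level x ≡ suc (p + m) + level y
    end≡ = cong suc (begin
      p + suc m + level x    ≡⟨ cong (_+ level x) (+-suc p m) ⟩
      suc (p + m) + level x  ≡⟨ +-suc (p + m) (level x) ⟨
      p + m + suc (level x)  ≡⟨ cong (λ l → p + m + l) level≡ ⟨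
      p + m + level y        ∎)
      where open ≡-Reasoning

  step-jump : ∀ {σ p m q x q′} (i : Fin (length s)) → p + m ≡ toℕ i → Invariant σ p m q x →
              child x (lookup s i) ≡ inj₁ q′ → Step (body σ i) p m (level x)
  step-jump {σ@(config _ (_ , _) _)} {p} {m} {q} {x} {q′} i i≡
    I@(record { index≡ = refl ; cur≡ = refl }) ch =
      jump (proj₂ (root-invariant index≡′ redirected≡ state≡′ r≤ result⇔′))
    where
    l = level x
    r = suc (p + m + l)
    c = lookup s i
    σ′ = body σ i
    redirected≡ = proj₁ (redirected-leaf x c ch)
    offset≡ = proj₂ (redirected-leaf x c ch)
    r≤ : r ≤ length s
    r≤ = end≤length I (subst (_< length s) (sym i≡) (toℕ<n i))
    index≡′ : index σ′ ≡ + r ℤ.+ (+ look q′ ℤ.- + 1)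
    index≡′ = trans (cong (λ o → + (p + m) ℤ.+ o) offset≡) (jump-index (p + m) l (look q′))
    r≡ : r ≡ p + (m + suc l)
    r≡ = sym (trans (sym (+-assoc p m (suc l))) (+-suc (p + m) l))
    state≡′ : stateAt r ≡ q′
    state≡′ with resolves-child I i i≡
    ... | t rewrite child-leaf x c ch with leaf h ← t = begin
      stateAt r                                        ≡⟨ cong stateAt r≡ ⟩
      stateAt (p + (m + suc l))                        ≡⟨ stateAt-+ p (m + suc l) ⟩
      δ* (stateAt p) (word p (m + suc l))              ≡⟨ cong₂ δ* (state≡ I) (word-+ p m (suc l)) ⟩
      -- The leaf speaks of every word of length `m`, hence also of the characters of `s` that were
      -- left unread.
      δ* q (word p m ++ word (p + m) (suc l))          ≡⟨ h (word p m) (length-word p m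
                                                           (≤-trans (≤-trans (m≤m+n (p + m) l) (n≤1+n _)) r≤)) ⟩
      q′                                               ∎
      where open ≡-Reasoning
    -- Subtracting `Φ` cancels the lookahead that the jump added to `r`.
    position≡ : index σ′ ℤ.- (+ look q′ ℤ.- + 1) ≡ + r
    position≡ = trans (cong (ℤ._- (+ look q′ ℤ.- + 1)) index≡′) (i+j-j≡i (+ r) (+ look q′ ℤ.- + 1))
    -- These positions lie inside the lookahead of `q`, so only `r` itself remains to be decided.
    between : ∀ j → p < j → j ≤ p + m + l → stateAt j ∉ F
    between j p<j j≤ = skipped-nonfinal p j p<j
      (subst (λ g → j < p + g) (trans (sym (look≡ I)) (cong look (sym (state≡ I))))
         (subst (j <_) (trans r≡ (cong (λ z → p + z) (+-suc m l))) (s≤s j≤)))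
      (≤-trans j≤ (≤-trans (n≤1+n _) r≤))
    skip = AcceptedUpTo-skip (≤-trans (m≤m+n p m) (m≤m+n (p + m) l)) between
    result⇔′ : ∀ z → z List.∈ result σ′ ⇔ AcceptedUpTo r z
    result⇔′ z = mk⇔ f g
      where
      res = result-body σ i redirected≡ z
      f : z List.∈ result σ′ → AcceptedUpTo r z
      f z∈ with to res z∈
      ... | inj₁ z∈′ = from (AcceptedUpTo-suc _ z) (inj₁ (to (skip z) (to (result⇔ I z) z∈′)))
      ... | inj₂ (fin , z≡) = from (AcceptedUpTo-suc _ z)
              (inj₂ (subst (_∈ F) (sym state≡′) (FinalRoot⇒∈F fin) , trans z≡ position≡))
      g : AcceptedUpTo r z → z List.∈ result σ′
      g acc with to (AcceptedUpTo-suc _ z) acc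
      ... | inj₁ acc′ = from res (inj₁ (from (result⇔ I z) (from (skip z) acc′)))
      ... | inj₂ (fin , z≡) = from res
              (inj₂ ((q′ , subst (_∈ F) state≡′ fin , refl) , trans z≡ (sym position≡)))

  step : ∀ {σ p m q x} (i : Fin (length s)) → index σ ≡ + toℕ i → Invariant σ p m q x →
         Step (body σ i) p m (level x)
  step {p = p} {m} {x = x} i i≡ I with child x (lookup s i) in ch
  ... | inj₁ q′ = step-jump i (ℤ.+-injective (trans (sym (index≡ I)) i≡)) I ch
  ... | inj₂ y with Resolves-positive D (subst (Resolves D _ m _) (proj₂ (child-node x _ ch))
                      (resolves-child I i (ℤ.+-injective (trans (sym (index≡ I)) i≡))))
  ...   | m′ , refl = step-down i (ℤ.+-injective (trans (sym (index≡ I)) i≡)) I ch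

  -- Going down decreases m, and fuel bounds the number of jumps, as every
  -- jump increases p.

  run-exists : ∀ fuel m {σ p q x} → Invariant σ p m q x → length s ≤ p + fuel →
               ∃₂ λ reads R → Run σ reads R
  run-exists fuel m {σ} {p} I le with length s ≤? p + m
  ... | yes stop = [] , result σ , halt (subst (+ length s ℤ.≤_) (sym (index≡ I)) (+≤+ stop))
  ... | no  cont = continue fuel m (step i i≡ I) le
    where
    i = fromℕ< (≰⇒> cont)
    i≡ : index σ ≡ + toℕ i
    i≡ = trans (index≡ I) (cong +_ (sym (toℕ-fromℕ< (≰⇒> cont))))
    -- `fuel` and `m` are arguments again so that their decrease is visible to the termination
    -- checker.
    continue : ∀ fuel m {l} → Step (body σ i) p m l → length s ≤ p + fuel → ∃₂ λ reads R → Run σ reads R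
    continue fuel (suc m) (down refl _ I′) le with run-exists fuel m I′ le
    ... | reads , R , run = i ∷ reads , R , loop i i≡ run
    -- Without fuel `p` has reached the end of `s`, yet the jump would land beyond `p` and still
    -- within `s`.
    continue zero m {l} (jump I′) le =
      ⊥-elim (<⇒≱ (s≤s (≤-trans (m≤m+n p m) (m≤m+n (p + m) l)))
        (≤-trans (p≤ I′) (subst (length s ≤_) (+-identityʳ p) le)))
    continue (suc fuel) m {l} (jump {m′} I′) le with run-exists fuel m′ I′
      (≤-trans le (≤-trans (≤-reflexive (+-suc p fuel))
        (s≤s (+-monoˡ-≤ fuel (≤-trans (m≤m+n p m) (m≤m+n (p + m) l))))))
    ... | reads , R , run = i ∷ reads , R , loop i i≡ run

  -- The indices in the interval from p + m + 1 to p + m + l, as well as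
  -- those below p, are the ones behind the automaton.

  Unread : ℕ → ℕ → ℕ → Fin (length s) → Set
  Unread p m l r = p ≤ toℕ r × (toℕ r ≤ p + m ⊎ suc (p + m + l) ≤ toℕ r)

  -- The unread indices only shrink, and the one just read drops out; the latter makes the reads
  -- distinct.
  unread-down : ∀ {p m l r} → Unread p m (suc l) r → Unread p (suc m) l r × p + suc m ≢ toℕ r
  unread-down {p} {m} {l} (p≤r , inj₁ r≤) =
    (p≤r , inj₁ (≤-trans r≤ (+-monoʳ-≤ p (n≤1+n m)))) ,
    λ eq → <⇒≱ (+-monoʳ-< p (n<1+n m)) (subst (_≤ p + m) (sym eq) r≤)
  unread-down {p} {m} {l} {r} (p≤r , inj₂ ≤r) = (p≤r , inj₂ ≤r′) ,
    λ eq → <⇒≱ (s≤s (m≤m+n (p + suc m) l)) (subst (suc (p + suc m + l) ≤_) (sym eq) ≤r′)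
    where
    ≤r′ : suc (p + suc m + l) ≤ toℕ r
    ≤r′ = subst (λ i → suc i ≤ toℕ r)
      (trans (+-suc (p + m) l) (cong (_+ l) (sym (+-suc p m)))) ≤r

  unread-jump : ∀ {p m l m′ r} → Unread (suc (p + m + l)) m′ 0 r → Unread p m l r × p + m ≢ toℕ r
  unread-jump {p} {m} {l} (≤r , _) =
    (≤-trans (≤-trans (m≤m+n p m) (m≤m+n (p + m) l)) (<⇒≤ ≤r) , inj₂ ≤r) ,
    λ eq → <⇒≱ (s≤s (m≤m+n (p + m) l)) (subst (suc (p + m + l) ≤_) (sym eq) ≤r)

  -- Induction on the run. Uniqueness alone would not carry over to a longer list, so the location
  -- of the later reads is proved along with it.
  run-correct : ∀ {σ p m q x reads R} → Invariant σ p m q x → Run σ reads R →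
                (∀ z → z List.∈ R ⇔ AcceptedUpTo (length s) z) ×
                Unique reads × All (Unread p m (level x)) reads
  run-correct {σ} {p} {m} {q} {x} I (halt le) =
    (λ z → mk⇔ (λ z∈ → to (skip z) (to (result⇔ I z) z∈)) (λ acc → from (result⇔ I z) (from (skip z) acc)))
    , [] , []
    where
    length≤ : length s ≤ p + m
    length≤ = ℤ.drop‿+≤+ (subst (+ length s ℤ.≤_) (index≡ I) le)
    -- On halting, the rest of `s` is shorter than the lookahead at `p`, so no accepted position is
    -- missed.
    skip = AcceptedUpTo-skip (p≤ I) λ j p<j j≤ → skipped-nonfinal p j p<j
      (subst (λ g → j < p + g) (trans (sym (look≡ I)) (cong look (sym (state≡ I))))
        (≤-trans (s≤s (≤-trans j≤ length≤))
          (≤-trans (≤-reflexive (sym (+-suc p m))) (+-monoʳ-≤ p (s≤s (m≤m+n m (level x)))))))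
      j≤
  run-correct {σ} {p} {m} {x = x} I (loop {reads} {R} i i≡ run) = extend (step i i≡ I)
    where
    p+m≡i : p + m ≡ toℕ i
    p+m≡i = ℤ.+-injective (trans (sym (index≡ I)) i≡)

    i-unread : Unread p m (level x) i
    i-unread = subst (p ≤_) p+m≡i (m≤m+n p m) , inj₁ (≤-reflexive (sym p+m≡i))

    add : ∀ {Q : Fin (length s) → Set} → (∀ {r} → Q r → Unread p m (level x) r × p + m ≢ toℕ r) →
          Unique reads × All Q reads → Unique (i ∷ reads) × All (Unread p m (level x)) (i ∷ reads)
    add f (unique , all) =
      All.map (λ u i≡r → proj₂ (f u) (trans p+m≡i (cong toℕ i≡r))) all ∷ unique ,
      i-unread ∷ All.map (λ u → proj₁ (f u)) all

    extend : Step (body σ i) p m (level x) →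
             (∀ z → z List.∈ R ⇔ AcceptedUpTo (length s) z) ×
             Unique (i ∷ reads) × All (Unread p m (level x)) (i ∷ reads)
    extend (down refl level≡ I′) with solution , rest ← run-correct I′ run =
      solution , add (λ {r} u → unread-down (subst (λ l → Unread p _ l r) level≡ u)) rest
    extend (jump I′) with solution , rest ← run-correct I′ run = solution , add unread-jump rest

mainTheorem2 : ∀ {n k : ℕ} .{{_ : NonZero k}}
    (e : RegExp k) (D : DFA n k) → D EquivalentTo (Σ*∙ e) →
    (budget : Budget n k) (terminates : BudgetTerminates D budget) →
    (s : List (Fin k)) →
    let M = BuildOFA D budget terminates in
    (∃₂ λ reads R → MatchUsingOFA M s reads R) ×
    (∀ reads R → MatchUsingOFA M s reads R →
    SolvesFindEndPositions s e R × Unique reads × length reads ≤ length s)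
mainTheorem2 {k = k} e D equivalent budget terminates s =
  -- The run starts at position 0, and each jump gains at least one position.
  run-exists (length s) _ (proj₂ initial-invariant) ≤-refl ,
  λ reads R run →
    let solution , unique , _ = run-correct (proj₂ initial-invariant) run in
    (λ z → mk⇔ (λ z∈ → accepted⇒end (to (solution z) z∈)) (λ end → from (solution z) (end⇒accepted end))) ,
    unique , Unique⇒length≤ unique
  where
  open Correctness D budget terminates s

  accepted⇒end : ∀ {z} → AcceptedUpTo (length s) z → ∃ λ p → z ≡ + p × EndOfMatch s e p
  accepted⇒end (p , z≡ , p≤ , f) =
    p , z≡ , from (endOfMatch⇔ s e p) (p≤ , to (equivalent (take p s)) f)

  end⇒accepted : ∀ {z} → (∃ λ p → z ≡ + p × EndOfMatch s e p) → AcceptedUpTo (length s) z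
  end⇒accepted (p , z≡ , end) with p≤ , m ← to (endOfMatch⇔ s e p) end =
    p , z≡ , p≤ , from (equivalent (take p s)) m
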